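{- Let $(G,\precsim)$ be a C-quasi-ordered group and let $H$ be a strictly convex normal subgroup of $G$. Then $\precsim$ induces a (well-defined) C-quasi-order on $G/H$ by the formula $$gH\precsim hH\Leftrightarrow (g\in H)\vee(h\notin H\wedge g\precsim h).$$
   Context: A quasi-order is a reflexive, transitive and total binary relation $\precsim$; $a\sim b$ means $a\precsim b\precsim a$, and $a\precnsim b$ means $a\precsim b$ and $a\nsim b$. A subset $S$ is strictly convex if $s,t\in S$ and $s\precnsim a\precnsim t$ imply $a\in S$. A C-relation on a set is a ternary relation $C$ such that for all $x,y,z,w$: $C(x,y,z)\Rightarrow C(x,z,y)$; $C(x,y,z)\Rightarrow\neg C(y,x,z)$; $C(x,y,z)\Rightarrow C(w,y,z)\vee C(x,w,z)$; $x\neq y\Rightarrow C(x,y,y)$. On a group it is compatible if $C(x,y,z)$ implies $C(vxu,vyu,vzu)$ for all $x,y,z,u,v$. A C-quasi-order on a group $G$ is a quasi-order of the form $x\precsim y\Leftrightarrow\neg C(x,y,1)$ with $C$ a compatible C-relation on $G$; a C-quasi-ordered group is a group with a C-quasi-order. -}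

module Defs where

open import Level using (Level; _⊔_; suc)
open import Algebra.Bundles using (Group)
import Algebra.Properties.Group as GroupProperties
open import Data.Product using (_×_; _,_)
open import Data.Sum using (_⊎_)
open import Function.Bundles using (_⇔_)
open import Relation.Binary.Core using (Rel)
open import Relation.Binary.Bundles using (Setoid)
open import Relation.Binary.Structures using (IsTotalPreorder)
open import Relation.Nullary using (¬_)
open import Relation.Unary using (Pred; _∈_; _∉_)
import Relation.Binary.Reasoning.Setoid as SetoidReasoning

private
  variable
    a ℓ q p : Level

module _ {A : Set a} (_≾_ : Rel A q) where

  Sim : Rel A q
  Sim x y = (x ≾ y) × (y ≾ x)

  StrictlyBelow : Rel A q
  StrictlyBelow x y = (x ≾ y) × ¬ Sim x y

  StrictlyConvex : Pred A p → Set (a ⊔ q ⊔ p)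
  StrictlyConvex S = ∀ {s t x} → s ∈ S → t ∈ S →
    StrictlyBelow s x → StrictlyBelow x t → x ∈ S

-- Sets are setoids here, so a relation on a set must respect the setoid
-- equality; `resp` says only this.
record IsCRelation (X : Setoid a ℓ)
                   (C : (x y z : Setoid.Carrier X) → Set q) : Set (a ⊔ ℓ ⊔ q) where
  open Setoid X
  field
    resp    : ∀ {x x′ y y′ z z′} → x ≈ x′ → y ≈ y′ → z ≈ z′ →
              C x y z → C x′ y′ z′
    swap    : ∀ x y z → C x y z → C x z y
    asym    : ∀ x y z → C x y z → ¬ C y x z
    split   : ∀ x y z w → C x y z → C w y z ⊎ C x w z
    distinct : ∀ x y → ¬ (x ≈ y) → C x y y

module _ (G : Group a ℓ) where
  open Group G

  Compatible : (Carrier → Carrier → Carrier → Set q) → Set (a ⊔ q)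
  Compatible C = ∀ x y z u v → C x y z →
    C ((v ∙ x) ∙ u) ((v ∙ y) ∙ u) ((v ∙ z) ∙ u)

  -- Quasi-orders are total, i.e. total preorders in the library's terms.
  -- Taking C in the same universe as _≾_ loses nothing classically: by
  -- compatibility, C x y z is equivalent to ¬ ((x ∙ z ⁻¹) ≾ (y ∙ z ⁻¹)).
  record IsCQuasiOrder (_≾_ : Rel Carrier q) : Set (a ⊔ ℓ ⊔ suc q) where
    field
      isQuasiOrder : IsTotalPreorder _≈_ _≾_
      C            : Carrier → Carrier → Carrier → Set q
      isCRelation  : IsCRelation setoid C
      compatible   : Compatible C
      ≾⇔¬C         : ∀ x y → (x ≾ y) ⇔ (¬ C x y ε)

  record IsNormalSubgroup (H : Pred Carrier p) : Set (a ⊔ ℓ ⊔ p) where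
    field
      resp      : ∀ {x y} → x ≈ y → x ∈ H → y ∈ H
      ε-closed  : ε ∈ H
      ∙-closed  : ∀ {x y} → x ∈ H → y ∈ H → (x ∙ y) ∈ H
      ⁻¹-closed : ∀ {x} → x ∈ H → (x ⁻¹) ∈ H
      normal    : ∀ g {x} → x ∈ H → ((g ∙ x) ∙ g ⁻¹) ∈ H

  SameCoset : Pred Carrier p → Rel Carrier p
  SameCoset H g h = (g ⁻¹ ∙ h) ∈ H

  -- An element g of the carrier stands for the coset gH.
  QuotientRel : Pred Carrier p → Rel Carrier q → Rel Carrier (p ⊔ q)
  QuotientRel H _≾_ g h = g ∈ H ⊎ (h ∉ H × g ≾ h)

  -- G/H is the carrier of G with `SameCoset H` as its equality.
  quotientGroup : (H : Pred Carrier p) → IsNormalSubgroup H → Group a p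
  quotientGroup H N = record
    { Carrier = Carrier
    ; _≈_     = SameCoset H
    ; _∙_     = _∙_
    ; ε       = ε
    ; _⁻¹     = _⁻¹
    ; isGroup = record
      { isMonoid = record
        { isSemigroup = record
          { isMagma = record
            { isEquivalence = record
              { refl  = fromEq refl
              ; sym   = ∼-sym
              ; trans = λ {x} {y} {z} r s → N.resp (telescope x y z) (N.∙-closed r s)
              }
            ; ∙-cong = ∙-cong′
            }
          ; assoc = λ x y z → fromEq (assoc x y z)
          }
        ; identity = (λ x → fromEq (identityˡ x)) , (λ x → fromEq (identityʳ x))
        }
      ; inverse = (λ x → fromEq (inverseˡ x)) , (λ x → fromEq (inverseʳ x))
      ; ⁻¹-cong = ⁻¹-cong′
      }
    }
    where
    module N = IsNormalSubgroup N
    open GroupProperties G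
    open SetoidReasoning setoid

    fromEq : ∀ {x y} → x ≈ y → SameCoset H x y
    fromEq {x} {y} x≈y =
      N.resp (sym (trans (∙-congˡ (sym x≈y)) (inverseˡ x))) N.ε-closed

    inv-diff : ∀ x y → (x ⁻¹ ∙ y) ⁻¹ ≈ y ⁻¹ ∙ x
    inv-diff x y = trans (⁻¹-anti-homo-∙ (x ⁻¹) y) (∙-congˡ (⁻¹-involutive x))

    ∼-sym : ∀ {x y} → SameCoset H x y → SameCoset H y x
    ∼-sym {x} {y} r = N.resp (inv-diff x y) (N.⁻¹-closed r)

    telescope : ∀ x y z → (x ⁻¹ ∙ y) ∙ (y ⁻¹ ∙ z) ≈ x ⁻¹ ∙ z
    telescope x y z = begin
      (x ⁻¹ ∙ y) ∙ (y ⁻¹ ∙ z) ≈⟨ assoc _ _ _ ⟩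
      x ⁻¹ ∙ (y ∙ (y ⁻¹ ∙ z)) ≈⟨ ∙-congˡ (assoc _ _ _) ⟨
      x ⁻¹ ∙ ((y ∙ y ⁻¹) ∙ z) ≈⟨ ∙-congˡ (∙-congʳ (inverseʳ y)) ⟩
      x ⁻¹ ∙ (ε ∙ z)          ≈⟨ ∙-congˡ (identityˡ z) ⟩
      x ⁻¹ ∙ z                ∎

    ∙-cong′ : ∀ {x y u v} → SameCoset H x y → SameCoset H u v →
              SameCoset H (x ∙ u) (y ∙ v)
    ∙-cong′ {x} {y} {u} {v} r s =
      N.resp eq (N.∙-closed (N.normal (u ⁻¹) r) s)
      where
      eq : ((u ⁻¹ ∙ (x ⁻¹ ∙ y)) ∙ (u ⁻¹) ⁻¹) ∙ (u ⁻¹ ∙ v) ≈ (x ∙ u) ⁻¹ ∙ (y ∙ v)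
      eq = begin
        ((u ⁻¹ ∙ (x ⁻¹ ∙ y)) ∙ (u ⁻¹) ⁻¹) ∙ (u ⁻¹ ∙ v)
          ≈⟨ assoc _ _ _ ⟩
        (u ⁻¹ ∙ (x ⁻¹ ∙ y)) ∙ ((u ⁻¹) ⁻¹ ∙ (u ⁻¹ ∙ v))
          ≈⟨ ∙-congˡ (assoc _ _ _) ⟨
        (u ⁻¹ ∙ (x ⁻¹ ∙ y)) ∙ (((u ⁻¹) ⁻¹ ∙ u ⁻¹) ∙ v)
          ≈⟨ ∙-congˡ (trans (∙-congʳ (inverseˡ (u ⁻¹))) (identityˡ v)) ⟩
        (u ⁻¹ ∙ (x ⁻¹ ∙ y)) ∙ v
          ≈⟨ ∙-congʳ (assoc _ _ _) ⟨
        ((u ⁻¹ ∙ x ⁻¹) ∙ y) ∙ v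
          ≈⟨ assoc _ _ _ ⟩
        (u ⁻¹ ∙ x ⁻¹) ∙ (y ∙ v)
          ≈⟨ ∙-congʳ (⁻¹-anti-homo-∙ x u) ⟨
        (x ∙ u) ⁻¹ ∙ (y ∙ v) ∎

    ⁻¹-cong′ : ∀ {x y} → SameCoset H x y → SameCoset H (x ⁻¹) (y ⁻¹)
    ⁻¹-cong′ {x} {y} r = N.resp eq (N.normal x (∼-sym r))
      where
      eq : (x ∙ (y ⁻¹ ∙ x)) ∙ x ⁻¹ ≈ (x ⁻¹) ⁻¹ ∙ y ⁻¹
      eq = begin
        (x ∙ (y ⁻¹ ∙ x)) ∙ x ⁻¹ ≈⟨ assoc _ _ _ ⟩
        x ∙ ((y ⁻¹ ∙ x) ∙ x ⁻¹) ≈⟨ ∙-congˡ (assoc _ _ _) ⟩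
        x ∙ (y ⁻¹ ∙ (x ∙ x ⁻¹)) ≈⟨ ∙-congˡ (∙-congˡ (inverseʳ x)) ⟩
        x ∙ (y ⁻¹ ∙ ε)          ≈⟨ ∙-congˡ (identityʳ _) ⟩
        x ∙ y ⁻¹                ≈⟨ ∙-congʳ (⁻¹-involutive x) ⟨
        (x ⁻¹) ⁻¹ ∙ y ⁻¹        ∎

{-# OPTIONS --safe #-}
-- Since ε is the least element, a strictly convex subgroup H contains
-- everything strictly below one of its elements.  It follows that if
-- C x y z and x lies in the coset of y, then so does z.  Hence C x y ε only
-- depends on the cosets of x and y when these avoid H, and G/H carries the
-- C-relation saying that x ∙ z ⁻¹ avoids H and either y ∙ z ⁻¹ lies in H or C x y z.
module Submission where

open import Defs
open import Level using (Level; _⊔_; Lift; lift; lower)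
open import Algebra.Bundles using (Group)
import Algebra.Properties.Group as GroupProperties
open import Axiom.ExcludedMiddle using (ExcludedMiddle)
open import Data.Product using (_×_; _,_; proj₁; proj₂)
open import Data.Sum using (_⊎_; inj₁; inj₂; [_,_])
open import Function.Base using (_∘_)
open import Function.Bundles using (Equivalence; _⇔_; mk⇔)
open import Relation.Binary.Core using (Rel)
open import Relation.Binary.Definitions using (_Respects₂_; Reflexive; Transitive; Total)
import Relation.Binary.Reasoning.Setoid as SetoidReasoning
open import Relation.Binary.Structures using (IsTotalPreorder)
open import Relation.Nullary using (¬_; Dec; yes; no; contradiction)
open import Relation.Nullary.Decidable using (map′)
open import Relation.Unary using (Pred; _∈_; _∉_)

lowerExcludedMiddle : ∀ {a} b → ExcludedMiddle (a ⊔ b) → ExcludedMiddle a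
lowerExcludedMiddle b em = map′ lower lift (em {Lift b _})

-- Right quotients and conjugates in a normal subgroup.

module NormalSubgroup {a ℓ p} (G : Group a ℓ) {H : Pred (Group.Carrier G) p}
                      (N : IsNormalSubgroup G H) where
  open Group G
  open GroupProperties G
  open SetoidReasoning setoid
  private module N = IsNormalSubgroup N

  ∙⁻¹-swap : ∀ {x y} → (x ∙ y ⁻¹) ∈ H → (y ∙ x ⁻¹) ∈ H
  ∙⁻¹-swap {x} {y} r = N.resp (⁻¹-anti-homo-// x y) (N.⁻¹-closed r)

  ∙⁻¹-trans : ∀ {x y z} → (x ∙ y ⁻¹) ∈ H → (y ∙ z ⁻¹) ∈ H → (x ∙ z ⁻¹) ∈ H
  ∙⁻¹-trans {x} {y} {z} r s = N.resp eq (N.∙-closed r s)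
    where
    eq : (x ∙ y ⁻¹) ∙ (y ∙ z ⁻¹) ≈ x ∙ z ⁻¹
    eq = trans (sym (assoc _ _ _)) (∙-congʳ (//-rightDividesˡ y x))

  ⁻¹-closed⁻ : ∀ {x} → (x ⁻¹) ∈ H → x ∈ H
  ⁻¹-closed⁻ {x} r = N.resp (⁻¹-involutive x) (N.⁻¹-closed r)

  normal⁻ : ∀ g {x} → ((g ∙ x) ∙ g ⁻¹) ∈ H → x ∈ H
  normal⁻ g {x} r = N.resp eq (N.normal (g ⁻¹) r)
    where
    eq : (g ⁻¹ ∙ ((g ∙ x) ∙ g ⁻¹)) ∙ (g ⁻¹) ⁻¹ ≈ x
    eq = begin
      (g ⁻¹ ∙ ((g ∙ x) ∙ g ⁻¹)) ∙ (g ⁻¹) ⁻¹ ≈⟨ ∙-congʳ (assoc _ _ _) ⟨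
      ((g ⁻¹ ∙ (g ∙ x)) ∙ g ⁻¹) ∙ (g ⁻¹) ⁻¹ ≈⟨ //-rightDividesʳ (g ⁻¹) _ ⟩
      g ⁻¹ ∙ (g ∙ x)                        ≈⟨ \\-leftDividesʳ g x ⟩
      x                                     ∎

  ≈⇒SameCoset : ∀ {x y} → x ≈ y → SameCoset G H x y
  ≈⇒SameCoset {x} x≈y = N.resp (trans (sym (inverseˡ x)) (∙-congˡ x≈y)) N.ε-closed

  -- Conjugating `x ⁻¹ ∙ y` by `x` gives `y ∙ x ⁻¹`, so normality lets the left cosets of
  -- `SameCoset` be tested by right quotients.
  SameCoset⇒∙⁻¹ : ∀ {x y} → SameCoset G H x y → (y ∙ x ⁻¹) ∈ H
  SameCoset⇒∙⁻¹ {x} {y} r =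
    N.resp (∙-congʳ (\\-leftDividesˡ x y)) (N.normal x r)

  ∙⁻¹⇒SameCoset : ∀ {x y} → (y ∙ x ⁻¹) ∈ H → SameCoset G H x y
  ∙⁻¹⇒SameCoset {x} {y} r = normal⁻ x (N.resp (∙-congʳ (sym (\\-leftDividesˡ x y))) r)

  ∈-respects-SameCoset : ∀ {x y} → SameCoset G H x y → x ∈ H → y ∈ H
  ∈-respects-SameCoset {x} {y} r x∈H = N.resp (\\-leftDividesˡ x y) (N.∙-closed x∈H r)

  -- The right factor cancels and the left one acts by conjugation, so compatibility on the quotient
  -- reduces to invariance under conjugation.
  ∙⁻¹-translate : ∀ v x z u →
    ((v ∙ x) ∙ u) ∙ ((v ∙ z) ∙ u) ⁻¹ ≈ (v ∙ (x ∙ z ⁻¹)) ∙ v ⁻¹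
  ∙⁻¹-translate v x z u = begin
    ((v ∙ x) ∙ u) ∙ ((v ∙ z) ∙ u) ⁻¹      ≈⟨ ∙-congˡ (⁻¹-anti-homo-∙ (v ∙ z) u) ⟩
    ((v ∙ x) ∙ u) ∙ (u ⁻¹ ∙ (v ∙ z) ⁻¹)   ≈⟨ assoc _ _ _ ⟨
    (((v ∙ x) ∙ u) ∙ u ⁻¹) ∙ (v ∙ z) ⁻¹   ≈⟨ ∙-congʳ (//-rightDividesʳ u _) ⟩
    (v ∙ x) ∙ (v ∙ z) ⁻¹                  ≈⟨ ∙-congˡ (⁻¹-anti-homo-∙ v z) ⟩
    (v ∙ x) ∙ (z ⁻¹ ∙ v ⁻¹)               ≈⟨ assoc _ _ _ ⟨
    ((v ∙ x) ∙ z ⁻¹) ∙ v ⁻¹               ≈⟨ ∙-congʳ (assoc _ _ _) ⟩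
    (v ∙ (x ∙ z ⁻¹)) ∙ v ⁻¹               ∎

module Quotient {a ℓ q p} (em : ExcludedMiddle (a ⊔ ℓ ⊔ q ⊔ p))
  (G : Group a ℓ) {_≾_ : Rel (Group.Carrier G) q} (Q : IsCQuasiOrder G _≾_)
  {H : Pred (Group.Carrier G) p} (N : IsNormalSubgroup G H)
  (convex : StrictlyConvex _≾_ H) where

  open Group G
  open GroupProperties G
  open NormalSubgroup G N
  open IsCQuasiOrder Q
  private
    module N = IsNormalSubgroup N
    module C = IsCRelation isCRelation
    module Q = IsTotalPreorder isQuasiOrder
    module G/H = Group (quotientGroup G H N)

  _∈H? : ∀ x → Dec (x ∈ H)
  x ∈H? = lowerExcludedMiddle (a ⊔ ℓ ⊔ q) em

  _≈?ε : ∀ x → Dec (x ≈ ε)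
  x ≈?ε = lowerExcludedMiddle (a ⊔ q ⊔ p) em

  -- The C-relation of G, strict convexity and cosets.

  ¬C⇒≾ : ∀ {x y} → ¬ C x y ε → x ≾ y
  ¬C⇒≾ = Equivalence.from (≾⇔¬C _ _)

  C⇒⋨ : ∀ {x y} → C x y ε → StrictlyBelow _≾_ y x
  C⇒⋨ c = ¬C⇒≾ (C.asym _ _ _ c) , λ y∼x → Equivalence.to (≾⇔¬C _ _) (proj₂ y∼x) c

  C-translateʳ : ∀ {x y z} u → C x y z → C (x ∙ u) (y ∙ u) (z ∙ u)
  C-translateʳ u c =
    C.resp (∙-congʳ (identityˡ _)) (∙-congʳ (identityˡ _)) (∙-congʳ (identityˡ _))
      (compatible _ _ _ u ε c)

  -- The order sees `C` only when the last argument is `ε`; right translation brings every triple to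
  -- that form.
  C-divideʳ : ∀ {x y z} → C x y z → C (x ∙ z ⁻¹) (y ∙ z ⁻¹) ε
  C-divideʳ {z = z} c = C.resp refl refl (inverseʳ z) (C-translateʳ (z ⁻¹) c)

  C-divideʳ⁻ : ∀ {x y z} → C (x ∙ z ⁻¹) (y ∙ z ⁻¹) ε → C x y z
  C-divideʳ⁻ {z = z} c =
    C.resp (//-rightDividesˡ z _) (//-rightDividesˡ z _) (identityˡ z) (C-translateʳ z c)

  C-conjugate : ∀ {x y} v → C x y ε → C ((v ∙ x) ∙ v ⁻¹) ((v ∙ y) ∙ v ⁻¹) ε
  C-conjugate v c =
    C.resp refl refl (trans (∙-congʳ (identityʳ v)) (inverseʳ v)) (compatible _ _ _ (v ⁻¹) v c)

  -- For `y` other than the identity, `distinct` puts `ε` strictly below `y`, and the hypothesis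
  -- puts `y` strictly below `x`, so convexity applies between `ε` and `x`. The identity is a
  -- separate case because convexity asks for strict inequalities on both sides.
  downward-closed : ∀ {x y} → C x y ε → x ∈ H → y ∈ H
  downward-closed {x} {y} c x∈H with y ≈?ε
  ... | yes y≈ε = N.resp (sym y≈ε) N.ε-closed
  ... | no  y≉ε = convex N.ε-closed x∈H (C⇒⋨ (C.distinct y ε y≉ε)) (C⇒⋨ c)

  -- After `swap` and right division by `y`, the element `z ∙ y ⁻¹` lies strictly below `x ∙ y ⁻¹`.
  coset-propagates : ∀ {x y z} → C x y z → (x ∙ y ⁻¹) ∈ H → (z ∙ y ⁻¹) ∈ H
  coset-propagates c = downward-closed (C-divideʳ (C.swap _ _ _ c))

  -- Otherwise the coset of `y` would propagate to `ε`, which forces `y ⁻¹`, hence `y`, into `H`.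
  sameCoset⇒¬C : ∀ {x y} → SameCoset G H y x → y ∉ H → ¬ C x y ε
  sameCoset⇒¬C {x} {y} r y∉H c =
    y∉H (⁻¹-closed⁻ (N.resp (identityˡ _) (coset-propagates c (SameCoset⇒∙⁻¹ r))))

  -- The negation of `QuotientRel` in positive form: the coset of `x` lies strictly above that of
  -- `y`.
  Above : Rel Carrier (q ⊔ p)
  Above x y = x ∉ H × (y ∈ H ⊎ C x y ε)

  Above-resp : ∀ {x x′ y y′} → SameCoset G H x x′ → SameCoset G H y y′ →
               Above x y → Above x′ y′
  Above-resp {x} {x′} {y} {y′} x∼x′ y∼y′ (x∉H , y-below) = x′∉H , y′-below y-below
    where
    x′∉H : x′ ∉ H
    x′∉H = x∉H ∘ ∈-respects-SameCoset (G/H.sym {x} {x′} x∼x′)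

    y′-below : y ∈ H ⊎ C x y ε → y′ ∈ H ⊎ C x′ y′ ε
    y′-below (inj₁ y∈H) = inj₁ (∈-respects-SameCoset y∼y′ y∈H)
    -- A first `split` replaces `x` by `x′`, since `C x x′ ε` cannot hold inside one coset outside
    -- `H`; a second one replaces `y` by `y′` in the same way.
    y′-below (inj₂ c) with y ∈H? | C.split x y ε x′ c
    ... | yes y∈H | _       = inj₁ (∈-respects-SameCoset y∼y′ y∈H)
    ... | no  _   | inj₂ c′ = contradiction c′ (sameCoset⇒¬C (G/H.sym {x} {x′} x∼x′) x′∉H)
    ... | no  y∉H | inj₁ c′ with C.split x′ y ε y′ c′
    ...   | inj₁ c″ = contradiction c″ (sameCoset⇒¬C y∼y′ y∉H)
    ...   | inj₂ c″ = inj₂ c″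

  Above-conjugate : ∀ {x y} v → Above x y → Above ((v ∙ x) ∙ v ⁻¹) ((v ∙ y) ∙ v ⁻¹)
  Above-conjugate v (x∉H , inj₁ y∈H) = x∉H ∘ normal⁻ v , inj₁ (N.normal v y∈H)
  Above-conjugate v (x∉H , inj₂ c)   = x∉H ∘ normal⁻ v , inj₂ (C-conjugate v c)

  -- The quasi-order on the quotient.

  infix 4 _≾/H_
  _≾/H_ : Rel Carrier (q ⊔ p)
  _≾/H_ = QuotientRel G H _≾_

  ≾/H⇔¬Above : ∀ {x y} → x ≾/H y ⇔ (¬ Above x y)
  ≾/H⇔¬Above {x} {y} = mk⇔ to from
    where
    to : x ≾/H y → ¬ Above x y
    to (inj₁ x∈H)         (x∉H , _)        = x∉H x∈H
    to (inj₂ (y∉H , _))   (_   , inj₁ y∈H) = y∉H y∈H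
    to (inj₂ (_   , x≾y)) (_   , inj₂ c)   = Equivalence.to (≾⇔¬C x y) x≾y c

    from : ¬ Above x y → x ≾/H y
    from ¬above with x ∈H?
    ... | yes x∈H = inj₁ x∈H
    ... | no  x∉H = inj₂ ((λ y∈H → ¬above (x∉H , inj₁ y∈H)) , ¬C⇒≾ (λ c → ¬above (x∉H , inj₂ c)))

  -- By contraposition: the invariance of `Above` is used along the reversed coset equalities.
  ≾/H-resp : ∀ {x x′ y y′} → SameCoset G H x x′ → SameCoset G H y y′ →
             x ≾/H y → x′ ≾/H y′
  ≾/H-resp {x} {x′} {y} {y′} x∼x′ y∼y′ x≾y = Equivalence.from ≾/H⇔¬Above
    (Equivalence.to ≾/H⇔¬Above x≾y ∘ Above-resp (G/H.sym {x} {x′} x∼x′) (G/H.sym {y} {y′} y∼y′))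

  ≾/H-resp₂ : _≾/H_ Respects₂ SameCoset G H
  ≾/H-resp₂ = (λ {x} → ≾/H-resp (G/H.refl {x})) ,
              (λ {y} x∼x′ → ≾/H-resp x∼x′ (G/H.refl {y}))

  ≾/H-refl : Reflexive _≾/H_
  ≾/H-refl {x} with x ∈H?
  ... | yes x∈H = inj₁ x∈H
  ... | no  x∉H = inj₂ (x∉H , Q.refl)

  ≾/H-trans : Transitive _≾/H_
  ≾/H-trans (inj₁ x∈H)         _                  = inj₁ x∈H
  ≾/H-trans (inj₂ (y∉H , _))   (inj₁ y∈H)         = contradiction y∈H y∉H
  ≾/H-trans (inj₂ (_   , x≾y)) (inj₂ (z∉H , y≾z)) = inj₂ (z∉H , Q.trans x≾y y≾z)

  ≾/H-total : Total _≾/H_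
  ≾/H-total x y with x ∈H? | y ∈H? | Q.total x y
  ... | yes x∈H | _       | _        = inj₁ (inj₁ x∈H)
  ... | no _    | yes y∈H | _        = inj₂ (inj₁ y∈H)
  ... | no _    | no y∉H  | inj₁ x≾y = inj₁ (inj₂ (y∉H , x≾y))
  ... | no x∉H  | no _    | inj₂ y≾x = inj₂ (inj₂ (x∉H , y≾x))

  ≾/H-isTotalPreorder : IsTotalPreorder (SameCoset G H) _≾/H_
  ≾/H-isTotalPreorder = record
    { isPreorder = record
      { isEquivalence = G/H.isEquivalence
      ; reflexive     = λ {x} x∼y → ≾/H-resp (G/H.refl {x}) x∼y ≾/H-refl
      ; trans         = ≾/H-trans
      }
    ; total = ≾/H-total
    }

  -- The C-relation on the quotient.

  C/H : Carrier → Carrier → Carrier → Set (q ⊔ p)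
  C/H x y z = Above (x ∙ z ⁻¹) (y ∙ z ⁻¹)

  C/H-swap : ∀ x y z → C/H x y z → C/H x z y
  C/H-swap x y z (xz⁻¹∉H , y-below) with (y ∙ z ⁻¹) ∈H? | y-below
  -- Here `y` and `z` share a coset, and `x` lies outside it.
  ... | yes yz⁻¹∈H | _ =
    (λ xy⁻¹∈H → xz⁻¹∉H (∙⁻¹-trans xy⁻¹∈H yz⁻¹∈H)) , inj₁ (∙⁻¹-swap yz⁻¹∈H)
  ... | no yz⁻¹∉H | inj₁ yz⁻¹∈H = contradiction yz⁻¹∈H yz⁻¹∉H
  -- If `x` shared the coset of `y`, then so would `z`.
  ... | no yz⁻¹∉H | inj₂ c =
    (λ xy⁻¹∈H → yz⁻¹∉H (∙⁻¹-swap (coset-propagates (C-divideʳ⁻ c) xy⁻¹∈H))) ,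
    inj₂ (C-divideʳ (C.swap _ _ _ (C-divideʳ⁻ c)))

  C/H-isCRelation : IsCRelation (Group.setoid (quotientGroup G H N)) C/H
  C/H-isCRelation = record
    { resp     = λ {x} {x′} {y} {y′} {z} {z′} x∼x′ y∼y′ z∼z′ →
        let z⁻¹∼z′⁻¹ = G/H.⁻¹-cong {z} {z′} z∼z′ in
        Above-resp (G/H.∙-cong {x} {x′} {z ⁻¹} {z′ ⁻¹} x∼x′ z⁻¹∼z′⁻¹)
                   (G/H.∙-cong {y} {y′} {z ⁻¹} {z′ ⁻¹} y∼y′ z⁻¹∼z′⁻¹)
    ; swap     = C/H-swap
    ; asym     = λ x y z → asym
    ; split    = λ x y z w → split
    ; distinct = λ x y x≁y →
        (λ xy⁻¹∈H → x≁y (∙⁻¹⇒SameCoset (∙⁻¹-swap xy⁻¹∈H))) ,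
        inj₁ (N.resp (sym (inverseʳ y)) N.ε-closed)
    }
    where
    asym : ∀ {x y} → Above x y → ¬ Above y x
    asym (x∉H , _)        (_   , inj₁ x∈H) = x∉H x∈H
    asym (_   , inj₁ y∈H) (y∉H , inj₂ _)   = y∉H y∈H
    asym (_   , inj₂ c)   (_   , inj₂ c′)  = C.asym _ _ _ c c′

    split : ∀ {x y w} → Above x y → Above w y ⊎ Above x w
    split {w = w} (x∉H , y-below) with w ∈H? | y-below
    -- Everything outside `H` is above everything inside it, which settles the first two cases; the
    -- third falls back on `split` in G.
    ... | yes w∈H | _        = inj₂ (x∉H , inj₁ w∈H)
    ... | no  w∉H | inj₁ y∈H = inj₁ (w∉H , inj₁ y∈H)
    ... | no  w∉H | inj₂ c   =
      [ (λ c′ → inj₁ (w∉H , inj₂ c′)) , (λ c′ → inj₂ (x∉H , inj₂ c′)) ] (C.split _ _ _ w c)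

  C/H-compatible : Compatible (quotientGroup G H N) C/H
  C/H-compatible x y z u v above =
    Above-resp (≈⇒SameCoset (sym (∙⁻¹-translate v x z u)))
               (≈⇒SameCoset (sym (∙⁻¹-translate v y z u)))
               (Above-conjugate v above)

  ≾/H-isCQuasiOrder : IsCQuasiOrder (quotientGroup G H N) _≾/H_
  ≾/H-isCQuasiOrder = record
    { isQuasiOrder = ≾/H-isTotalPreorder
    ; C            = C/H
    ; isCRelation  = C/H-isCRelation
    ; compatible   = C/H-compatible
    -- `C/H x y ε` speaks of `x ∙ ε ⁻¹` and `y ∙ ε ⁻¹`, which represent the cosets of `x` and `y`;
    -- the invariance of `Above` removes the difference.
    ; ≾⇔¬C         = λ x y → mk⇔
        (λ x≾y → Equivalence.to ≾/H⇔¬Above x≾y ∘ Above-resp (xε⁻¹∼x x) (xε⁻¹∼x y))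
        (λ ¬above → Equivalence.from ≾/H⇔¬Above
          (¬above ∘ Above-resp (G/H.sym {x ∙ ε ⁻¹} {x} (xε⁻¹∼x x)) (G/H.sym {y ∙ ε ⁻¹} {y} (xε⁻¹∼x y))))
    }
    where
    xε⁻¹∼x : ∀ x → SameCoset G H (x ∙ ε ⁻¹) x
    xε⁻¹∼x x = ≈⇒SameCoset (trans (∙-congˡ ε⁻¹≈ε) (identityʳ x))

proposition3p11 : ∀ {a ℓ q p : Level} → ExcludedMiddle (a ⊔ ℓ ⊔ q ⊔ p) →
    (G : Group a ℓ) (_≾_ : Rel (Group.Carrier G) q) → IsCQuasiOrder G _≾_ →
    (H : Pred (Group.Carrier G) p) (N : IsNormalSubgroup G H) → StrictlyConvex _≾_ H →
    (QuotientRel G H _≾_ Respects₂ SameCoset G H)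
    × IsCQuasiOrder (quotientGroup G H N) (QuotientRel G H _≾_)
proposition3p11 em G _ Q _ N convex = ≾/H-resp₂ , ≾/H-isCQuasiOrder
  where open Quotient em G Q N convex
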